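{- Let $m\ge 0$, $n=m+3$, and let $\mathcal F=(W_{i,j})$ be a closed decorated frieze of width $m$. Then $$W_{i+n,j+n}=W_{i,j}$$ for all $i,j\in\mathbb Z$ with $0\le j-i\le n$. Moreover, since the boundary decorations $y_1,\dots,y_n$ are algebraically independent variables, $n$ is the least positive period of $\mathcal F$, i.e. the least integer $p>0$ such that $W_{i+p,j+p}=W_{i,j}$ for all $i,j\in\mathbb Z$ with $0\le j-i\le n$.
   Context: Fix an integer $m\ge 0$ and put $n=m+3$. Let $x_1,\dots,x_m,y_1,\dots,y_n$ be algebraically independent variables, extend $y_{i+n}=y_i$ for $i\in\mathbb Z$, and put $\mathscr R_m=\mathbb Z[x_1^{\pm1},\dots,x_m^{\pm1},y_1^{\pm1},\dots,y_n^{\pm1}]$. A closed decorated frieze of width $m$ is a family $\mathcal F=(W_{i,j})$ of elements of $\mathscr R_m$, indexed by $i,j\in\mathbb Z$ with $0\le j-i\le n$, such that: (D1) $W_{i,i}=0$ and $W_{i,i+n}=0$ for all $i$; (D2) $W_{i,i+1}=y_i$ and $W_{i,i+n-1}=y_{i-1}$ for all $i$; (D3) every interior entry, i.e. every $W_{i,j}$ with $2\le j-i\le n-2$, is nonzero; (D4) for all $i,j$ with $1\le j-i\le n-1$, $W_{i,j}W_{i+1,j+1}-W_{i+1,j}W_{i,j+1}=y_iy_j$. No periodicity of the entries is assumed. -}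

module Defs where

open import Algebra.Bundles.Raw using (RawRing)
open import Data.Fin using (Fin; fromℕ<; _↑ʳ_)
open import Data.Integer as ℤ using (ℤ; +_; 0ℤ; 1ℤ; _≤_; _<_)
open import Data.Integer.DivMod using (_%ℕ_; n%ℕd<d)
open import Data.Integer.Properties using () renaming (_≟_ to _≟ℤ_)
open import Data.List using (List; []; _∷_; [_]; _++_; map; cartesianProductWith)
open import Data.Nat as ℕ using (ℕ)
open import Data.Product using (_×_; _,_)
open import Data.Vec using (Vec; replicate; zipWith; _[_]≔_)
open import Data.Vec.Properties using (≡-dec)
open import Level using (0ℓ)
open import Relation.Binary.PropositionalEquality using (_≡_)
open import Relation.Nullary using (¬_; yes; no)

-- ℤ[z₁^±1, …, z_k^±1].  A term (c , e) stands for c · z₁^e₁ ⋯ z_k^e_k, with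
-- exponents of either sign, and a list of terms for its sum.  The list need not
-- be reduced: equality of Laurent polynomials is equality of all coefficients.

Exponent : ℕ → Set
Exponent k = Vec ℤ k

Term : ℕ → Set
Term k = ℤ × Exponent k

Laurent : ℕ → Set
Laurent k = List (Term k)

coeff : ∀ {k} → Laurent k → Exponent k → ℤ
coeff [] e = 0ℤ
coeff ((c , e′) ∷ p) e with ≡-dec _≟ℤ_ e′ e
... | yes _ = c ℤ.+ coeff p e
... | no  _ = coeff p e

mulTerm : ∀ {k} → Term k → Term k → Term k
mulTerm (c , e) (d , f) = c ℤ.* d , zipWith ℤ._+_ e f

laurentRing : ℕ → RawRing 0ℓ 0ℓ
laurentRing k = record
  { Carrier = Laurent k
  ; _≈_     = λ p q → ∀ e → coeff p e ≡ coeff q e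
  ; _+_     = _++_
  ; _*_     = cartesianProductWith mulTerm
  ; -_      = map λ (c , e) → ℤ.- c , e
  ; 0#      = []
  ; 1#      = [ 1ℤ , replicate k 0ℤ ]
  }

var : ∀ {k} → Fin k → Laurent k
var {k} i = [ 1ℤ , replicate k 0ℤ [ i ]≔ 1ℤ ]

order : ℕ → ℕ
order m = 3 ℕ.+ m

-- The first m variables are x₁, …, x_m and the last n are y₁, …, y_n.
𝓡 : ℕ → RawRing 0ℓ 0ℓ
𝓡 m = laurentRing (m ℕ.+ order m)

-- y m i is y_i for 1 ≤ i ≤ n, extended n-periodically to all i ∈ ℤ; the shift
-- by one accounts for Fin being indexed from 0.
y : ∀ m → ℤ → RawRing.Carrier (𝓡 m)
y m i = var (m ↑ʳ fromℕ< (n%ℕd<d (i ℤ.- 1ℤ) (order m)))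

-- A family of ring elements indexed by 0 ≤ j - i ≤ n is given by a function on
-- all of ℤ × ℤ whose values outside that strip are never referred to.
Family : ℕ → Set
Family m = ℤ → ℤ → RawRing.Carrier (𝓡 m)

record IsClosedDecoratedFrieze (m : ℕ) (W : Family m) : Set where
  open RawRing (𝓡 m)
  n : ℤ
  n = + order m
  field
    zeroˡ     : ∀ i → W i i ≈ 0#
    zeroʳ     : ∀ i → W i (i ℤ.+ n) ≈ 0#
    boundaryˡ : ∀ i → W i (i ℤ.+ 1ℤ) ≈ y m i
    boundaryʳ : ∀ i → W i (i ℤ.+ n ℤ.- 1ℤ) ≈ y m (i ℤ.- 1ℤ)
    nonzero   : ∀ i j → + 2 ≤ j ℤ.- i → j ℤ.- i ≤ n ℤ.- + 2 → ¬ (W i j ≈ 0#)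
    diamond   : ∀ i j → 1ℤ ≤ j ℤ.- i → j ℤ.- i ≤ n ℤ.- 1ℤ →
                W i j * W (i ℤ.+ 1ℤ) (j ℤ.+ 1ℤ) + - (W (i ℤ.+ 1ℤ) j * W i (j ℤ.+ 1ℤ))
                  ≈ y m i * y m j

IsPeriod : ∀ m → Family m → ℤ → Set
IsPeriod m W p = ∀ i j → 0ℤ ≤ j ℤ.- i → j ℤ.- i ≤ + order m →
                 W (i ℤ.+ p) (j ℤ.+ p) ≈ W i j
  where open RawRing (𝓡 m)

record IsLeastPositivePeriod (m : ℕ) (W : Family m) (p : ℤ) : Set where
  field
    positive : 0ℤ < p
    isPeriod : IsPeriod m W p
    least    : ∀ q → 0ℤ < q → IsPeriod m W q → p ≤ q

{-# OPTIONS --safe #-}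

-- Combining adjacent diamond relations shows that consecutive columns of the
-- frieze satisfy a three-term recurrence y_{j-1} W_{i,j+1} + y_j W_{i,j-1} =
-- W_{j-1,j+1} W_{i,j}, and that consecutive rows satisfy a recurrence with the
-- same coefficients.  Hence j ↦ W_{i,j} and j ↦ W_{j,i+n} solve the same
-- recurrence with the same initial values, so W_{i,j} = W_{j,i+n}; applying this
-- glide symmetry twice gives the period n.  It needs cancellation of nonzero
-- factors, which holds in the Laurent polynomial ring because the
-- lexicographically leading coefficient of a product is the product of the
-- leading coefficients.  A period p forces y_{1+p} = y_1, hence n ∣ p.
module Submission where

open import Defs
open import Algebra.Bundles using (AbelianGroup; CommutativeRing)
open import Algebra.Bundles.Raw using (RawRing)
open import Algebra.Definitions
  using (Associative; Commutative; Congruent₁; Congruent₂; LeftIdentity; RightInverse; _DistributesOverʳ_)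
import Algebra.Properties.Group
import Algebra.Properties.Ring
open import Data.Bool using (if_then_else_)
open import Data.Fin using (Fin; fromℕ<; toℕ)
open import Data.Fin.Properties as Finₚ using ()
open import Data.Integer as ℤ using (ℤ; +_; 0ℤ; 1ℤ; +≤+; +<+)
open import Data.Integer.DivMod using (_%ℕ_; n%ℕd<d)
open import Data.Integer.Properties as ℤₚ using () renaming (_≟_ to _≟ℤ_)
open import Data.Integer.Tactic.RingSolver using (solve-∀)
open import Data.List using ([]; _∷_; map; filter; length)
open import Data.List.Membership.Propositional using (_∈_)
open import Data.List.Properties as Listₚ using (filter-notAll)
open import Data.List.Relation.Unary.All as All using (All; []; _∷_)
open import Data.List.Relation.Unary.Any using (here; there)
open import Data.Nat as ℕ using (ℕ; zero; suc; z≤n; s≤s)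
open import Data.Nat.DivMod using (m<n⇒m%n≡m)
open import Data.Nat.Properties as ℕₚ using ()
open import Data.Product using (_×_; _,_; proj₁; proj₂; ∃)
open import Data.Sum using (_⊎_; inj₁; inj₂; [_,_]′)
open import Data.Vec using ([]; _∷_; lookup; replicate; zipWith; _[_]≔_)
open import Data.Vec.Properties as Vecₚ using (≡-dec)
open import Data.Vec.Relation.Binary.Lex.Strict as Lex using (Lex-<)
open import Data.Vec.Relation.Binary.Pointwise.Inductive using (Pointwise-≡⇒≡; ≡⇒Pointwise-≡)
open import Function using (_∘_; flip; const)
open import Level using (0ℓ)
open import Relation.Binary.Bundles using (Setoid; StrictTotalOrder)
open import Relation.Binary.Definitions using (tri<; tri≈; tri>)
open import Relation.Binary.PropositionalEquality as ≡ using (_≡_; _≢_; _≗_; cong; cong₂; subst; subst₂)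
open import Relation.Binary.Structures using (IsEquivalence)
open import Relation.Nullary using (¬_; Dec; yes; no; does; ¬?; contradiction)

-- Three-term recurrences and glide symmetry over a commutative ring.

module ThreeTermRelations {c ℓ} (R : CommutativeRing c ℓ) where

  open CommutativeRing R
  open import Algebra.Properties.Group +-group using () renaming (∙-cancelʳ to +-cancelʳ)
  open import Algebra.Solver.Ring.NaturalCoefficients.Default commutativeSemiring
  open import Relation.Binary.Reasoning.Setoid setoid

  -- Two adjacent diamonds with decorations w·b and w·a propagate a three-term
  -- relation with coefficient s from the pair (q , v) to the pair (t , u).
  propagate : ∀ {p q r t u v w a b s} →
    p * q ≈ w * b + r * t → u * r ≈ w * a + v * p → a * q + b * v ≈ s * r →
    r * (a * t + b * u) ≈ r * (s * p)
  propagate {p} {q} {r} {t} {u} {v} {w} {a} {b} {s} pq ur rel =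
    +-cancelʳ (w * a * b) _ _ (begin
      r * (a * t + b * u) + w * a * b
        ≈⟨ solve 6 (λ r a t b u w → r :* (a :* t :+ b :* u) :+ w :* a :* b
             := a :* (w :* b :+ r :* t) :+ b :* (u :* r)) refl r a t b u w ⟩
      a * (w * b + r * t) + b * (u * r)
        ≈⟨ +-cong (*-congˡ (sym pq)) (*-congˡ ur) ⟩
      a * (p * q) + b * (w * a + v * p)
        ≈⟨ solve 6 (λ a p q b w v → a :* (p :* q) :+ b :* (w :* a :+ v :* p)
             := p :* (a :* q :+ b :* v) :+ w :* a :* b) refl a p q b w v ⟩
      p * (a * q + b * v) + w * a * b
        ≈⟨ +-congʳ (*-congˡ rel) ⟩
      p * (s * r) + w * a * b
        ≈⟨ +-congʳ (solve 3 (λ p s r → p :* (s :* r) := r :* (s :* p)) refl p s r) ⟩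
      r * (s * p) + w * a * b ∎)

  -- Start of the induction for both recurrences: `x` will be a zero on the border and `u` a
  -- boundary entry, so both sides reduce to `s * a`.
  relation-base : ∀ {a b s u x} → x ≈ 0# → u ≈ a → a * s + b * x ≈ s * u
  relation-base {a} {b} {s} {u} {x} x≈0 u≈a = begin
    a * s + b * x  ≈⟨ +-congˡ (*-congˡ x≈0) ⟩
    a * s + b * 0# ≈⟨ solve 3 (λ a s b → a :* s :+ b :* con 0 := s :* a) refl a s b ⟩
    s * a          ≈⟨ *-congˡ u≈a ⟨
    s * u          ∎

  module Glide
    (*-cancelˡ-nonZero : ∀ r {x z} → ¬ r ≈ 0# → r * x ≈ r * z → x ≈ z)
    {I : Set} (next : I → I) where

    infixl 6 _⊕_

    -- The base is shifted first, so `i ⊕ suc k` and `next i ⊕ k` are the same by definition; the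
    -- inductions that pass from row `i` to row `next i` rely on this.
    _⊕_ : I → ℕ → I
    i ⊕ zero  = i
    i ⊕ suc k = next i ⊕ k

    next-⊕ : ∀ i k → next (i ⊕ k) ≡ next i ⊕ k
    next-⊕ i zero    = ≡.refl
    next-⊕ i (suc k) = next-⊕ (next i) k

    ⊕-⊕ : ∀ i k l → i ⊕ k ⊕ l ≡ i ⊕ (k ℕ.+ l)
    ⊕-⊕ i zero    l = ≡.refl
    ⊕-⊕ i (suc k) l = ⊕-⊕ (next i) k l

    -- V i k is the entry W_{i,i+k} of a frieze of order 2 + n.
    module _ {n : ℕ} (y : I → Carrier) (V : I → ℕ → Carrier)
      (y≉0       : ∀ i → ¬ y i ≈ 0#)
      (zeroˡ     : ∀ i → V i 0 ≈ 0#)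
      (zeroʳ     : ∀ i → V i (2 ℕ.+ n) ≈ 0#)
      (boundaryˡ : ∀ i → V i 1 ≈ y i)
      (boundaryʳ : ∀ i → V (next i) (suc n) ≈ y i)
      (nonzero   : ∀ i k → k ℕ.< n → ¬ V i (suc k) ≈ 0#)
      (diamond   : ∀ i k → k ℕ.≤ n →
        V i (suc k) * V (next i) (suc k) ≈
        y i * y (i ⊕ suc k) + V (next i) k * V i (2 ℕ.+ k))
      where

      -- The relation for `next i` and `k` concerns the same columns and hence has the same
      -- coefficients. The two diamonds between rows `i` and `next i` carry it up to row `i`, after
      -- cancelling `V (next i) (suc k)`.
      columnRelation : ∀ i k → k ℕ.≤ n →
        y (i ⊕ k) * V i (2 ℕ.+ k) + y (i ⊕ suc k) * V i k
          ≈ V (i ⊕ k) 2 * V i (suc k)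
      columnRelation i zero    _   = relation-base (zeroˡ i) (boundaryˡ i)
      columnRelation i (suc k) k<n =
        *-cancelˡ-nonZero (V (next i) (suc k)) (nonzero (next i) k k<n) (propagate
          (diamond i (suc k) k<n)
          (diamond i k (ℕₚ.<⇒≤ k<n))
          (columnRelation (next i) k (ℕₚ.<⇒≤ k<n)))

      -- The mirror image: the rows and the coefficient `V i 2` stay fixed while the relation moves
      -- one column to the right.
      rowRelation : ∀ i k → k ℕ.≤ n →
        y (next i) * V i (2 ℕ.+ k) + y i * V (next (next i)) k
          ≈ V i 2 * V (next i) (suc k)
      rowRelation i zero    _   =
        relation-base (zeroˡ (next (next i))) (boundaryˡ (next i))
      rowRelation i (suc k) k<n =
        *-cancelˡ-nonZero (V (next i) (suc k)) (nonzero (next i) k k<n) (propagate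
          -- The decoration `w` shared by the two diamonds is now that of their common column,
          -- `y (i ⊕ suc (suc k))`; the commutations bring it to the front.
          (trans (*-comm _ _) (trans (diamond i (suc k) k<n) (+-congʳ (*-comm _ _))))
          (trans (*-comm _ _) (trans (diamond (next i) k (ℕₚ.<⇒≤ k<n)) (+-congʳ (*-comm _ _))))
          (rowRelation i k (ℕₚ.<⇒≤ k<n)))

      -- As functions of j, W_{i,j} and W_{j,i+n} have the same initial values, and
      -- the column and row relations are the same recurrence for both.
      glide : ∀ i k l → k ℕ.+ l ≡ 2 ℕ.+ n → V i k ≈ V (i ⊕ k) l
      glide i 0 l ≡.refl = trans (zeroˡ i) (sym (zeroʳ i))
      glide i 1 l ≡.refl = trans (boundaryˡ i) (sym (boundaryʳ i))
      glide i (suc (suc k)) l eq =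
        *-cancelˡ-nonZero (y (i ⊕ k)) (y≉0 (i ⊕ k)) (+-cancelʳ (y (i ⊕ suc k) * V i k) _ _ (begin
          y (i ⊕ k) * V i (2 ℕ.+ k) + y (i ⊕ suc k) * V i k
            ≈⟨ columnRelation i k k≤n ⟩
          V (i ⊕ k) 2 * V i (suc k)
            ≈⟨ *-congˡ (glide i (suc k) (suc l) (≡.trans (cong suc (ℕₚ.+-suc k l)) eq)) ⟩
          V (i ⊕ k) 2 * V (i ⊕ suc k) (suc l)
            ≈⟨ row ⟨
          y (i ⊕ suc k) * V (i ⊕ k) (2 ℕ.+ l) + y (i ⊕ k) * V (i ⊕ suc (suc k)) l
            ≈⟨ +-comm _ _ ⟩
          y (i ⊕ k) * V (i ⊕ suc (suc k)) l + y (i ⊕ suc k) * V (i ⊕ k) (2 ℕ.+ l)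
            ≈⟨ +-congˡ (*-congˡ (glide i k (2 ℕ.+ l) k+[2+l]≡2+n)) ⟨
          y (i ⊕ k) * V (i ⊕ suc (suc k)) l + y (i ⊕ suc k) * V i k ∎))
        where
        k+l≡n : k ℕ.+ l ≡ n
        k+l≡n = ℕₚ.suc-injective (ℕₚ.suc-injective eq)

        k≤n : k ℕ.≤ n
        k≤n = subst (k ℕ.≤_) k+l≡n (ℕₚ.m≤m+n k l)

        l≤n : l ℕ.≤ n
        l≤n = subst (l ℕ.≤_) k+l≡n (ℕₚ.m≤n+m l k)

        k+[2+l]≡2+n : k ℕ.+ (2 ℕ.+ l) ≡ 2 ℕ.+ n
        k+[2+l]≡2+n = ≡.trans (ℕₚ.+-suc k (suc l)) (≡.trans (cong suc (ℕₚ.+-suc k l)) eq)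

        row : y (i ⊕ suc k) * V (i ⊕ k) (2 ℕ.+ l) + y (i ⊕ k) * V (i ⊕ suc (suc k)) l
              ≈ V (i ⊕ k) 2 * V (i ⊕ suc k) (suc l)
        -- The rewrites express the shifts as `next` applied to row `i ⊕ k`. The double shift comes
        -- first, as unfolding it leaves `next i ⊕ k` for the second rewrite.
        row rewrite ≡.sym (next-⊕ (next i) k) | ≡.sym (next-⊕ i k) = rowRelation (i ⊕ k) l l≤n

      -- Two glides move the row by `k` and then by the complementary `l`, in total by the order.
      periodic : ∀ i k → k ℕ.≤ 2 ℕ.+ n → V (i ⊕ (2 ℕ.+ n)) k ≈ V i k
      periodic i k k≤2+n = sym (begin
        V i k               ≈⟨ glide i k l (ℕₚ.m+[n∸m]≡n k≤2+n) ⟩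
        V (i ⊕ k) l         ≈⟨ glide (i ⊕ k) l k (ℕₚ.m∸n+n≡m k≤2+n) ⟩
        V (i ⊕ k ⊕ l) k     ≡⟨ cong (λ j → V j k) (≡.trans (⊕-⊕ i k l) (cong (i ⊕_) (ℕₚ.m+[n∸m]≡n k≤2+n))) ⟩
        V (i ⊕ (2 ℕ.+ n)) k ∎)
        where l = 2 ℕ.+ n ℕ.∸ k

open ≡ using (refl; sym; trans; module ≡-Reasoning)

-- Laurent polynomials as functionals on functions of the exponent.

module LaurentRing (k : ℕ) where

  open RawRing (laurentRing k)
  open ≡-Reasoning
  open Algebra.Properties.Group (AbelianGroup.group ℤₚ.+-0-abelianGroup) using (∙-cancelˡ)

  infix 4 _≟_
  infixl 6 _⊹_

  _≟_ : (e f : Exponent k) → Dec (e ≡ f)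
  _≟_ = ≡-dec _≟ℤ_

  _⊹_ : Exponent k → Exponent k → Exponent k
  _⊹_ = zipWith ℤ._+_

  δ : Exponent k → Exponent k → ℤ
  δ g e = if does (e ≟ g) then 1ℤ else 0ℤ

  δ-≡ : ∀ {g e} → e ≡ g → δ g e ≡ 1ℤ
  δ-≡ {g} {e} e≡g with e ≟ g
  ... | yes _  = refl
  ... | no e≢g = contradiction e≡g e≢g

  δ-≢ : ∀ {g e} → e ≢ g → δ g e ≡ 0ℤ
  δ-≢ {g} {e} e≢g with e ≟ g
  ... | yes e≡g = contradiction e≡g e≢g
  ... | no _    = refl

  -- The linear extension of `h` from monomials to Laurent polynomials, computed term by term on a
  -- possibly unreduced list. Coefficients are the case `h = δ g`.
  extend : (Exponent k → ℤ) → Laurent k → ℤ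
  extend h []            = 0ℤ
  extend h ((c , e) ∷ p) = c ℤ.* h e ℤ.+ extend h p

  coeff-extend : ∀ p g → coeff p g ≡ extend (δ g) p
  coeff-extend []            g = refl
  coeff-extend ((c , e) ∷ p) g with e ≟ g
  ... | yes _ = cong₂ ℤ._+_ (sym (ℤₚ.*-identityʳ c)) (coeff-extend p g)
  ... | no _  = trans (coeff-extend p g)
    (sym (trans (cong (ℤ._+ extend (δ g) p) (ℤₚ.*-zeroʳ c)) (ℤₚ.+-identityˡ _)))

  extend-cong : ∀ {h h′} → h ≗ h′ → ∀ p → extend h p ≡ extend h′ p
  extend-cong h≗h′ []            = refl
  extend-cong h≗h′ ((c , e) ∷ p) =
    cong₂ ℤ._+_ (cong (c ℤ.*_) (h≗h′ e)) (extend-cong h≗h′ p)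

  extend-0 : ∀ p → extend (const 0ℤ) p ≡ 0ℤ
  extend-0 []            = refl
  extend-0 ((c , e) ∷ p) = cong₂ ℤ._+_ (ℤₚ.*-zeroʳ c) (extend-0 p)

  extend-linear : ∀ a h h′ p →
    extend (λ e → a ℤ.* h e ℤ.+ h′ e) p ≡ a ℤ.* extend h p ℤ.+ extend h′ p
  extend-linear a h h′ []            = sym (trans (ℤₚ.+-identityʳ _) (ℤₚ.*-zeroʳ a))
  extend-linear a h h′ ((c , e) ∷ p) rewrite extend-linear a h h′ p =
    rearrange a c (h e) (h′ e) _ _
    where
    rearrange : ∀ a c u v s t → c ℤ.* (a ℤ.* u ℤ.+ v) ℤ.+ (a ℤ.* s ℤ.+ t)
                ≡ a ℤ.* (c ℤ.* u ℤ.+ s) ℤ.+ (c ℤ.* v ℤ.+ t)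
    rearrange = solve-∀

  extend-+ : ∀ h p q → extend h (p + q) ≡ extend h p ℤ.+ extend h q
  extend-+ h []            q = sym (ℤₚ.+-identityˡ _)
  extend-+ h ((c , e) ∷ p) q =
    trans (cong (ℤ._+_ (c ℤ.* h e)) (extend-+ h p q)) (sym (ℤₚ.+-assoc (c ℤ.* h e) _ _))

  extend-neg : ∀ h p → extend h (- p) ≡ ℤ.- extend h p
  extend-neg h []            = refl
  extend-neg h ((c , e) ∷ p) rewrite extend-neg h p = negate c (h e) _
    where
    negate : ∀ c u s → ℤ.- c ℤ.* u ℤ.+ ℤ.- s ≡ ℤ.- (c ℤ.* u ℤ.+ s)
    negate = solve-∀

  extend-mulTerm : ∀ h c e q →
    extend h (map (mulTerm (c , e)) q) ≡ c ℤ.* extend (λ f → h (e ⊹ f)) q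
  extend-mulTerm h c e []            = sym (ℤₚ.*-zeroʳ c)
  extend-mulTerm h c e ((d , f) ∷ q) rewrite extend-mulTerm h c e q =
    factor c d (h (e ⊹ f)) _
    where
    factor : ∀ c d u s → c ℤ.* d ℤ.* u ℤ.+ c ℤ.* s ≡ c ℤ.* (d ℤ.* u ℤ.+ s)
    factor = solve-∀

  -- A product becomes an iterated sum, so the laws of multiplication reduce to those of `_⊹_` and
  -- to the interchange of finite sums.
  extend-* : ∀ h p q → extend h (p * q) ≡ extend (λ e → extend (λ f → h (e ⊹ f)) q) p
  extend-* h []            q = refl
  extend-* h ((c , e) ∷ p) q = trans
    (extend-+ h (map (mulTerm (c , e)) q) (p * q))
    (cong₂ ℤ._+_ (extend-mulTerm h c e q) (extend-* h p q))

  extend-swap : ∀ (h : Exponent k → Exponent k → ℤ) p q →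
    extend (λ e → extend (h e) q) p ≡ extend (λ f → extend (flip h f) p) q
  extend-swap h []            q = sym (extend-0 q)
  extend-swap h ((c , e) ∷ p) q = trans
    (cong (ℤ._+_ (c ℤ.* extend (h e) q)) (extend-swap h p q))
    (sym (extend-linear c (h e) (λ f → extend (flip h f) p) q))

  -- Collecting the terms with a given exponent.

  remove : Exponent k → Laurent k → Laurent k
  remove e = filter (λ t → ¬? (proj₂ t ≟ e))

  -- All terms with exponent `e`, wherever they stand in the list, are merged into one that carries
  -- their total coefficient.
  extend-remove : ∀ h e p → extend h p ≡ coeff p e ℤ.* h e ℤ.+ extend h (remove e p)
  extend-remove h e []            = refl
  extend-remove h e ((c , f) ∷ p) rewrite extend-remove h e p with f ≟ e
  ... | yes refl = collect c (h e) (coeff p e) _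
    where
    collect : ∀ c u d s → c ℤ.* u ℤ.+ (d ℤ.* u ℤ.+ s) ≡ (c ℤ.+ d) ℤ.* u ℤ.+ s
    collect = solve-∀
  ... | no _     = exchange (c ℤ.* h f) (coeff p e ℤ.* h e) _
    where
    exchange : ∀ u v s → u ℤ.+ (v ℤ.+ s) ≡ v ℤ.+ (u ℤ.+ s)
    exchange = solve-∀

  coeff-remove : ∀ e p f → coeff p f ≡ coeff p e ℤ.* δ f e ℤ.+ coeff (remove e p) f
  coeff-remove e p f = begin
    coeff p f                                             ≡⟨ coeff-extend p f ⟩
    extend (δ f) p                                        ≡⟨ extend-remove (δ f) e p ⟩
    coeff p e ℤ.* δ f e ℤ.+ extend (δ f) (remove e p)     ≡⟨ cong (ℤ._+_ (coeff p e ℤ.* δ f e)) (coeff-extend (remove e p) f) ⟨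
    coeff p e ℤ.* δ f e ℤ.+ coeff (remove e p) f          ∎

  coeff-remove-≡ : ∀ e p → coeff (remove e p) e ≡ 0ℤ
  coeff-remove-≡ e p = ∙-cancelˡ (coeff p e) _ _ (begin
    coeff p e ℤ.+ coeff (remove e p) e              ≡⟨ cong (ℤ._+ coeff (remove e p) e) (ℤₚ.*-identityʳ (coeff p e)) ⟨
    coeff p e ℤ.* 1ℤ ℤ.+ coeff (remove e p) e       ≡⟨ cong (λ d → coeff p e ℤ.* d ℤ.+ coeff (remove e p) e) (δ-≡ {e} refl) ⟨
    coeff p e ℤ.* δ e e ℤ.+ coeff (remove e p) e    ≡⟨ coeff-remove e p e ⟨
    coeff p e                                       ≡⟨ ℤₚ.+-identityʳ _ ⟨
    coeff p e ℤ.+ 0ℤ                                ∎)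

  coeff-remove-≢ : ∀ {e f} → e ≢ f → ∀ p → coeff (remove e p) f ≡ coeff p f
  coeff-remove-≢ {e} {f} e≢f p = begin
    coeff (remove e p) f                           ≡⟨ ℤₚ.+-identityˡ _ ⟨
    0ℤ ℤ.+ coeff (remove e p) f                    ≡⟨ cong (ℤ._+ coeff (remove e p) f) (ℤₚ.*-zeroʳ (coeff p e)) ⟨
    coeff p e ℤ.* 0ℤ ℤ.+ coeff (remove e p) f      ≡⟨ cong (λ d → coeff p e ℤ.* d ℤ.+ coeff (remove e p) f) (δ-≢ e≢f) ⟨
    coeff p e ℤ.* δ f e ℤ.+ coeff (remove e p) f   ≡⟨ coeff-remove e p f ⟨
    coeff p f                                      ∎

  -- The hypothesis controls total coefficients and not single terms, so each round removes every
  -- term that shares the exponent of the head. The bound `b` on the length makes this recursion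
  -- structural.
  extend-vanish : ∀ h p → (∀ e → coeff p e ℤ.* h e ≡ 0ℤ) → extend h p ≡ 0ℤ
  extend-vanish h p = go (suc (length p)) p ℕₚ.≤-refl
    where
    go : ∀ b p → length p ℕ.< b → (∀ e → coeff p e ℤ.* h e ≡ 0ℤ) → extend h p ≡ 0ℤ
    go (suc b) []              _   _     = refl
    go (suc b) p@((c , e) ∷ _) p<b vanish = begin
      extend h p                                    ≡⟨ extend-remove h e p ⟩
      coeff p e ℤ.* h e ℤ.+ extend h (remove e p)   ≡⟨ cong₂ ℤ._+_ (vanish e) (go b (remove e p) shorter vanish′) ⟩
      0ℤ                                            ∎
      where
      shorter : length (remove e p) ℕ.< b
      shorter = ℕₚ.<-≤-trans (filter-notAll (λ t → ¬? (proj₂ t ≟ e)) p (here λ e≢e → e≢e refl)) (ℕ.s≤s⁻¹ p<b)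

      vanish′ : ∀ f → coeff (remove e p) f ℤ.* h f ≡ 0ℤ
      vanish′ f with e ≟ f
      ... | yes refl = cong (ℤ._* h e) (coeff-remove-≡ e p)
      ... | no e≢f   = trans (cong (ℤ._* h f) (coeff-remove-≢ e≢f p)) (vanish f)

  extend-single : ∀ h p e₀ → (∀ e → e ≢ e₀ → coeff p e ℤ.* h e ≡ 0ℤ) →
    extend h p ≡ coeff p e₀ ℤ.* h e₀
  extend-single h p e₀ vanish = begin
    extend h p                                          ≡⟨ extend-remove h e₀ p ⟩
    coeff p e₀ ℤ.* h e₀ ℤ.+ extend h (remove e₀ p)      ≡⟨ cong (ℤ._+_ (coeff p e₀ ℤ.* h e₀)) (extend-vanish h (remove e₀ p) vanish′) ⟩
    coeff p e₀ ℤ.* h e₀ ℤ.+ 0ℤ                          ≡⟨ ℤₚ.+-identityʳ _ ⟩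
    coeff p e₀ ℤ.* h e₀                                 ∎
    where
    vanish′ : ∀ e → coeff (remove e₀ p) e ℤ.* h e ≡ 0ℤ
    vanish′ e with e₀ ≟ e
    ... | yes refl = cong (ℤ._* h e) (coeff-remove-≡ e p)
    ... | no e₀≢e  = trans (cong (ℤ._* h e) (coeff-remove-≢ e₀≢e p)) (vanish e (e₀≢e ∘ sym))

  coeff-+ : ∀ p q g → coeff (p + q) g ≡ coeff p g ℤ.+ coeff q g
  coeff-+ p q g
    rewrite coeff-extend (p + q) g | coeff-extend p g | coeff-extend q g = extend-+ (δ g) p q

  coeff-neg : ∀ p g → coeff (- p) g ≡ ℤ.- coeff p g
  coeff-neg p g rewrite coeff-extend (- p) g | coeff-extend p g = extend-neg (δ g) p

  -- The commutative ring structure.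

  infix 4 _≋_

  -- Equality of Laurent polynomials as linear functionals on functions of the
  -- exponent; in this form the ring laws become immediate.
  record _≋_ (p q : Laurent k) : Set where
    constructor mk≋
    field extend-≡ : ∀ h → extend h p ≡ extend h q
  open _≋_

  ≋⇒≈ : ∀ {p q} → p ≋ q → p ≈ q
  ≋⇒≈ {p} {q} p≋q g =
    trans (coeff-extend p g) (trans (extend-≡ p≋q (δ g)) (sym (coeff-extend q g)))

  -- A functional sees only coefficients: those of `p + - q` all vanish, so `extend-vanish` applies
  -- to the difference.
  ≈⇒≋ : ∀ {p q} → p ≈ q → p ≋ q
  ≈⇒≋ {p} {q} p≈q = mk≋ λ h → ℤₚ.i-j≡0⇒i≡j (extend h p) (extend h q) (begin
    extend h p ℤ.- extend h q       ≡⟨ cong (ℤ._+_ (extend h p)) (extend-neg h q) ⟨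
    extend h p ℤ.+ extend h (- q)   ≡⟨ extend-+ h p (- q) ⟨
    extend h (p + - q)              ≡⟨ extend-vanish h (p + - q) (λ e → cong (ℤ._* h e) (p-q≈0 e)) ⟩
    0ℤ                              ∎)
    where
    p-q≈0 : p + - q ≈ 0#
    p-q≈0 e = trans (coeff-+ p (- q) e)
      (trans (cong (ℤ._+_ (coeff p e)) (coeff-neg q e)) (ℤₚ.i≡j⇒i-j≡0 (p≈q e)))

  ≋-isEquivalence : IsEquivalence _≋_
  ≋-isEquivalence = record
    { refl  = mk≋ λ h → refl
    ; sym   = λ p≋q → mk≋ λ h → sym (extend-≡ p≋q h)
    ; trans = λ p≋q q≋r → mk≋ λ h → trans (extend-≡ p≋q h) (extend-≡ q≋r h)
    }

  +-cong : Congruent₂ _≋_ _+_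
  +-cong {p} {p′} {q} {q′} p≋p′ q≋q′ = mk≋ λ h → trans (extend-+ h p q)
    (trans (cong₂ ℤ._+_ (extend-≡ p≋p′ h) (extend-≡ q≋q′ h)) (sym (extend-+ h p′ q′)))

  +-assoc : Associative _≋_ _+_
  +-assoc p q r = mk≋ λ h → cong (extend h) (Listₚ.++-assoc p q r)

  +-comm : Commutative _≋_ _+_
  +-comm p q = mk≋ λ h →
    trans (extend-+ h p q) (trans (ℤₚ.+-comm (extend h p) _) (sym (extend-+ h q p)))

  -‿cong : Congruent₁ _≋_ -_
  -‿cong {p} {q} p≋q = mk≋ λ h →
    trans (extend-neg h p) (trans (cong ℤ.-_ (extend-≡ p≋q h)) (sym (extend-neg h q)))

  -‿inverseʳ : RightInverse _≋_ 0# -_ _+_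
  -‿inverseʳ p = mk≋ λ h → trans (extend-+ h p (- p))
    (trans (cong (ℤ._+_ (extend h p)) (extend-neg h p)) (ℤₚ.+-inverseʳ (extend h p)))

  *-cong : Congruent₂ _≋_ _*_
  *-cong {p} {p′} {q} {q′} p≋p′ q≋q′ = mk≋ λ h → begin
    extend h (p * q)                                ≡⟨ extend-* h p q ⟩
    extend (λ e → extend (λ f → h (e ⊹ f)) q) p     ≡⟨ extend-≡ p≋p′ _ ⟩
    extend (λ e → extend (λ f → h (e ⊹ f)) q) p′    ≡⟨ extend-cong (λ e → extend-≡ q≋q′ _) p′ ⟩
    extend (λ e → extend (λ f → h (e ⊹ f)) q′) p′   ≡⟨ extend-* h p′ q′ ⟨
    extend h (p′ * q′)                              ∎

  *-assoc : Associative _≋_ _*_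
  *-assoc p q r = mk≋ λ h → begin
    extend h ((p * q) * r)
      ≡⟨ extend-* h (p * q) r ⟩
    extend (λ e → extend (λ g → h (e ⊹ g)) r) (p * q)
      ≡⟨ extend-* _ p q ⟩
    extend (λ e → extend (λ f → extend (λ g → h (e ⊹ f ⊹ g)) r) q) p
      ≡⟨ extend-cong (λ e → extend-cong (λ f → extend-cong (λ g →
           cong h (Vecₚ.zipWith-assoc ℤₚ.+-assoc e f g)) r) q) p ⟩
    extend (λ e → extend (λ f → extend (λ g → h (e ⊹ (f ⊹ g))) r) q) p
      ≡⟨ extend-cong (λ e → extend-* _ q r) p ⟨
    extend (λ e → extend (λ f → h (e ⊹ f)) (q * r)) p
      ≡⟨ extend-* h p (q * r) ⟨
    extend h (p * (q * r)) ∎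

  *-comm : Commutative _≋_ _*_
  *-comm p q = mk≋ λ h → begin
    extend h (p * q)
      ≡⟨ extend-* h p q ⟩
    extend (λ e → extend (λ f → h (e ⊹ f)) q) p
      ≡⟨ extend-swap (λ e f → h (e ⊹ f)) p q ⟩
    extend (λ f → extend (λ e → h (e ⊹ f)) p) q
      ≡⟨ extend-cong (λ f → extend-cong (λ e →
           cong h (Vecₚ.zipWith-comm ℤₚ.+-comm e f)) p) q ⟩
    extend (λ f → extend (λ e → h (f ⊹ e)) p) q
      ≡⟨ extend-* h q p ⟨
    extend h (q * p) ∎

  *-identityˡ : LeftIdentity _≋_ 1# _*_
  *-identityˡ p = mk≋ λ h → begin
    extend h (1# * p)
      ≡⟨ extend-* h 1# p ⟩
    1ℤ ℤ.* extend (λ f → h (replicate k 0ℤ ⊹ f)) p ℤ.+ 0ℤ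
      ≡⟨ trans (ℤₚ.+-identityʳ _) (ℤₚ.*-identityˡ _) ⟩
    extend (λ f → h (replicate k 0ℤ ⊹ f)) p
      ≡⟨ extend-cong (λ f → cong h (Vecₚ.zipWith-identityˡ ℤₚ.+-identityˡ f)) p ⟩
    extend h p ∎

  *-distribʳ-+ : _DistributesOverʳ_ _≋_ _*_ _+_
  *-distribʳ-+ p q r = mk≋ λ h → begin
    extend h ((q + r) * p)
      ≡⟨ extend-* h (q + r) p ⟩
    extend (λ e → extend (λ f → h (e ⊹ f)) p) (q + r)
      ≡⟨ extend-+ _ q r ⟩
    extend (λ e → extend (λ f → h (e ⊹ f)) p) q ℤ.+ extend (λ e → extend (λ f → h (e ⊹ f)) p) r
      ≡⟨ cong₂ ℤ._+_ (extend-* h q p) (extend-* h r p) ⟨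
    extend h (q * p) ℤ.+ extend h (r * p)
      ≡⟨ extend-+ h (q * p) (r * p) ⟨
    extend h (q * p + r * p) ∎

  ≋-setoid : Setoid 0ℓ 0ℓ
  ≋-setoid = record { isEquivalence = ≋-isEquivalence }

  open import Algebra.Consequences.Setoid ≋-setoid
    using (comm∧idˡ⇒id; comm∧invʳ⇒inv; comm∧distrʳ⇒distr)

  commutativeRing : CommutativeRing 0ℓ 0ℓ
  commutativeRing = record
    { _≈_ = _≋_ ; _+_ = _+_ ; _*_ = _*_ ; -_ = -_ ; 0# = 0# ; 1# = 1#
    ; isCommutativeRing = record
      { isRing = record
        { +-isAbelianGroup = record
          { isGroup = record
            { isMonoid = record
              { isSemigroup = record
                { isMagma = record { isEquivalence = ≋-isEquivalence ; ∙-cong = +-cong }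
                ; assoc = +-assoc
                }
              ; identity = comm∧idˡ⇒id +-comm (λ p → mk≋ λ h → refl)
              }
            ; inverse = comm∧invʳ⇒inv +-comm -‿inverseʳ
            ; ⁻¹-cong = -‿cong
            }
          ; comm = +-comm
          }
        ; *-cong = *-cong
        ; *-assoc = *-assoc
        ; *-identity = comm∧idˡ⇒id *-comm *-identityˡ
        ; distrib = comm∧distrʳ⇒distr +-cong *-comm *-distribʳ-+
        }
      ; *-comm = *-comm
      }
    }

  -- Lexicographic leading terms and cancellation.

  open StrictTotalOrder (Lex.<-strictTotalOrder ℤₚ.<-strictTotalOrder k)
    using (compare) renaming (_<_ to _≺_; irrefl to ≺-irrefl; trans to ≺-trans)

  ≺⇒≢ : ∀ {e f} → e ≺ f → e ≢ f
  ≺⇒≢ e≺f refl = ≺-irrefl (≡⇒Pointwise-≡ refl) e≺f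

  ⊹-monoʳ-≺ : ∀ e {f g} → f ≺ g → e ⊹ f ≺ e ⊹ g
  ⊹-monoʳ-≺ = mono
    where
    -- Generalised over the length, since the induction on vectors changes it while the `k` of the
    -- module is fixed.
    mono : ∀ {k} (e : Exponent k) {f g} → Lex-< _≡_ ℤ._<_ f g →
           Lex-< _≡_ ℤ._<_ (zipWith ℤ._+_ e f) (zipWith ℤ._+_ e g)
    mono []      {[]} {[]} f≺g  = f≺g
    mono (a ∷ e) (Lex.this b<c n≡n)  = Lex.this (ℤₚ.+-monoʳ-< a b<c) n≡n
    mono (a ∷ e) (Lex.next b≡c f≺g)  = Lex.next (cong (ℤ._+_ a) b≡c) (mono e f≺g)

  ⊹-monoˡ-≺ : ∀ g {e f} → e ≺ f → e ⊹ g ≺ f ⊹ g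
  ⊹-monoˡ-≺ g {e} {f} e≺f =
    subst (_≺ _) (Vecₚ.zipWith-comm ℤₚ.+-comm g e)
      (subst (_ ≺_) (Vecₚ.zipWith-comm ℤₚ.+-comm g f) (⊹-monoʳ-≺ g e≺f))

  IsLeading : Laurent k → Exponent k → Set
  IsLeading p e = coeff p e ≢ 0ℤ × (∀ f → e ≺ f → coeff p f ≡ 0ℤ)

  -- Confines the support to a finite list of exponents, which can be searched for its maximum.
  coeff≢0⇒∈ : ∀ p {e} → coeff p e ≢ 0ℤ → e ∈ map proj₂ p
  coeff≢0⇒∈ []            {e} ≢0 = contradiction refl ≢0
  coeff≢0⇒∈ ((c , f) ∷ p) {e} ≢0 with f ≟ e
  ... | yes refl = here refl
  ... | no _     = there (coeff≢0⇒∈ p ≢0)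

  -- `search` finds the largest listed exponent with nonzero coefficient, or that all listed
  -- coefficients vanish. Unlisted exponents have coefficient zero, so either outcome extends to all
  -- exponents.
  leading : ∀ p → ¬ p ≈ 0# → ∃ (IsLeading p)
  leading p p≉0 with search (map proj₂ p)
    where
    search : ∀ es → All (λ e → coeff p e ≡ 0ℤ) es ⊎
      ∃ λ e → coeff p e ≢ 0ℤ × All (λ f → e ≺ f → coeff p f ≡ 0ℤ) es
    search []       = inj₁ []
    search (e ∷ es) with coeff p e ≟ℤ 0ℤ | search es
    ... | yes ≡0 | inj₁ zeros           = inj₁ (≡0 ∷ zeros)
    ... | yes ≡0 | inj₂ (f , ≢0 , max)  = inj₂ (f , ≢0 , const ≡0 ∷ max)
    ... | no  ≢0 | inj₁ zeros           =
      inj₂ (e , ≢0 , (λ e≺e → contradiction refl (≺⇒≢ e≺e)) ∷ All.map const zeros)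
    ... | no  ≢0 | inj₂ (f , ≢0′ , max) with compare e f
    ...   | tri< _ _ f⊀e = inj₂ (f , ≢0′ , (λ f≺e → contradiction f≺e f⊀e) ∷ max)
    ...   | tri≈ _ _ f⊀e = inj₂ (f , ≢0′ , (λ f≺e → contradiction f≺e f⊀e) ∷ max)
    ...   | tri> _ _ f≺e = inj₂ (e , ≢0 , (λ e≺e → contradiction refl (≺⇒≢ e≺e)) ∷
                             All.map (λ max-f e≺g → max-f (≺-trans f≺e e≺g)) max)
  ... | inj₁ zeros = contradiction p≈0 p≉0
    where
    p≈0 : p ≈ 0#
    p≈0 e with coeff p e ≟ℤ 0ℤ
    ... | yes ≡0 = ≡0
    ... | no ≢0  = All.lookup zeros (coeff≢0⇒∈ p ≢0)
  ... | inj₂ (e , ≢0 , max) = e , ≢0 , λ f e≺f → maximal f e≺f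
    where
    maximal : ∀ f → e ≺ f → coeff p f ≡ 0ℤ
    maximal f e≺f with coeff p f ≟ℤ 0ℤ
    ... | yes ≡0 = ≡0
    ... | no ≢0  = All.lookup max (coeff≢0⇒∈ p ≢0) e≺f

  -- The order is invariant under translation, so any pair of exponents other than `e₀` and `f₀`
  -- either meets a zero coefficient or has a sum strictly below `e₀ ⊹ f₀`.
  coeff-leading-* : ∀ p q {e₀ f₀} → IsLeading p e₀ → IsLeading q f₀ →
    coeff (p * q) (e₀ ⊹ f₀) ≡ coeff p e₀ ℤ.* coeff q f₀
  coeff-leading-* p q {e₀} {f₀} (_ , max-p) (_ , max-q) = begin
    coeff (p * q) (e₀ ⊹ f₀)
      ≡⟨ coeff-extend (p * q) (e₀ ⊹ f₀) ⟩
    extend (δ (e₀ ⊹ f₀)) (p * q)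
      ≡⟨ extend-* (δ (e₀ ⊹ f₀)) p q ⟩
    extend (λ e → extend (λ f → δ (e₀ ⊹ f₀) (e ⊹ f)) q) p
      ≡⟨ extend-single _ p e₀ outer ⟩
    coeff p e₀ ℤ.* extend (λ f → δ (e₀ ⊹ f₀) (e₀ ⊹ f)) q
      ≡⟨ cong (ℤ._*_ (coeff p e₀)) (extend-single _ q f₀ (inner e₀ (λ f f≺f₀ → ⊹-monoʳ-≺ e₀ f≺f₀))) ⟩
    coeff p e₀ ℤ.* (coeff q f₀ ℤ.* δ (e₀ ⊹ f₀) (e₀ ⊹ f₀))
      ≡⟨ cong (λ d → coeff p e₀ ℤ.* (coeff q f₀ ℤ.* d)) (δ-≡ {e₀ ⊹ f₀} refl) ⟩
    coeff p e₀ ℤ.* (coeff q f₀ ℤ.* 1ℤ)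
      ≡⟨ cong (ℤ._*_ (coeff p e₀)) (ℤₚ.*-identityʳ _) ⟩
    coeff p e₀ ℤ.* coeff q f₀ ∎
    where
    -- The assumption that sums lie below `e₀ ⊹ f₀` holds both for `e₀` itself and for `e ≺ e₀`, so
    -- the argument serves both sums.
    inner : ∀ e → (∀ f → f ≺ f₀ → e ⊹ f ≺ e₀ ⊹ f₀) →
      ∀ f → f ≢ f₀ → coeff q f ℤ.* δ (e₀ ⊹ f₀) (e ⊹ f) ≡ 0ℤ
    inner e below f f≢f₀ with compare f f₀
    ... | tri< f≺f₀ _ _ = trans (cong (ℤ._*_ (coeff q f)) (δ-≢ (≺⇒≢ (below f f≺f₀)))) (ℤₚ.*-zeroʳ (coeff q f))
    ... | tri≈ _ f≋f₀ _ = contradiction (Pointwise-≡⇒≡ f≋f₀) f≢f₀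
    ... | tri> _ _ f₀≺f = cong (ℤ._* δ (e₀ ⊹ f₀) (e ⊹ f)) (max-q f f₀≺f)

    outer : ∀ e → e ≢ e₀ →
      coeff p e ℤ.* extend (λ f → δ (e₀ ⊹ f₀) (e ⊹ f)) q ≡ 0ℤ
    outer e e≢e₀ with compare e e₀
    ... | tri≈ _ e≋e₀ _ = contradiction (Pointwise-≡⇒≡ e≋e₀) e≢e₀
    ... | tri> _ _ e₀≺e = cong (ℤ._* extend (λ f → δ (e₀ ⊹ f₀) (e ⊹ f)) q) (max-p e e₀≺e)
    ... | tri< e≺e₀ _ _ = trans (cong (ℤ._*_ (coeff p e)) (begin
      extend (λ f → δ (e₀ ⊹ f₀) (e ⊹ f)) q
        ≡⟨ extend-single _ q f₀ (inner e λ f f≺f₀ →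
             ≺-trans (⊹-monoʳ-≺ e f≺f₀) (⊹-monoˡ-≺ f₀ e≺e₀)) ⟩
      coeff q f₀ ℤ.* δ (e₀ ⊹ f₀) (e ⊹ f₀)
        ≡⟨ cong (ℤ._*_ (coeff q f₀)) (δ-≢ (≺⇒≢ (⊹-monoˡ-≺ f₀ e≺e₀))) ⟩
      coeff q f₀ ℤ.* 0ℤ
        ≡⟨ ℤₚ.*-zeroʳ (coeff q f₀) ⟩
      0ℤ ∎)) (ℤₚ.*-zeroʳ (coeff p e))

  *-nonZero : ∀ p q → ¬ p ≈ 0# → ¬ q ≈ 0# → ¬ p * q ≈ 0#
  *-nonZero p q p≉0 q≉0 pq≈0 with e₀ , lead-p ← leading p p≉0 | f₀ , lead-q ← leading q q≉0 =
    [ proj₁ lead-p , proj₁ lead-q ]′ (ℤₚ.i*j≡0⇒i≡0∨j≡0 (coeff p e₀)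
      (trans (sym (coeff-leading-* p q lead-p lead-q)) (pq≈0 (e₀ ⊹ f₀))))

  *-cancelˡ-nonZero : ∀ r {p q} → ¬ r ≋ 0# → r * p ≋ r * q → p ≋ q
  *-cancelˡ-nonZero r {p} {q} r≉0 rp≋rq = x∙y⁻¹≈ε⇒x≈y p q (≈⇒≋ p-q≈0)
    where
    module R = CommutativeRing commutativeRing
    open Algebra.Properties.Ring R.ring using (x[y-z]≈xy-xz)
    open Algebra.Properties.Group R.+-group using (x∙y⁻¹≈ε⇒x≈y; x≈y⇒x∙y⁻¹≈ε)

    r[p-q]≋0 : r * (p + - q) ≋ 0#
    r[p-q]≋0 = R.trans (x[y-z]≈xy-xz r p q) (x≈y⇒x∙y⁻¹≈ε rp≋rq)

    p-q≈0 : p + - q ≈ 0#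
    -- `*-nonZero` only refutes that the difference is nonzero; deciding each coefficient removes
    -- the double negation.
    p-q≈0 e with coeff (p + - q) e ≟ℤ 0ℤ
    ... | yes ≡0 = ≡0
    ... | no ≢0  = contradiction (≋⇒≈ r[p-q]≋0)
      (*-nonZero r (p + - q) (r≉0 ∘ ≈⇒≋) (λ p-q≈0 → ≢0 (p-q≈0 e)))

-- Variables are nonzero and pairwise distinct.

module _ {k : ℕ} where
  open LaurentRing k
  open ≡-Reasoning
  open RawRing (laurentRing k) using (_≈_; 0#)

  unit : Fin k → Exponent k
  unit i = replicate k 0ℤ [ i ]≔ 1ℤ

  coeff-var : ∀ i e → coeff (var i) e ≡ δ e (unit i)
  coeff-var i e = trans (coeff-extend (var i) e)
    (trans (ℤₚ.+-identityʳ _) (ℤₚ.*-identityˡ (δ e (unit i))))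

  var≉0 : ∀ i → ¬ var i ≈ 0#
  var≉0 i var≈0 with () ← trans (sym (trans (coeff-var i (unit i)) (δ-≡ {unit i} refl))) (var≈0 (unit i))

  unit-injective : ∀ {i j} → unit i ≡ unit j → i ≡ j
  unit-injective {i} {j} eq with i Finₚ.≟ j
  ... | yes i≡j = i≡j
  ... | no i≢j with () ← begin
      1ℤ                        ≡⟨ Vecₚ.lookup∘update i (replicate k 0ℤ) 1ℤ ⟨
      lookup (unit i) i         ≡⟨ cong (λ e → lookup e i) eq ⟩
      lookup (unit j) i         ≡⟨ Vecₚ.lookup∘update′ i≢j (replicate k 0ℤ) 1ℤ ⟩
      lookup (replicate k 0ℤ) i ≡⟨ Vecₚ.lookup-replicate i 0ℤ ⟩
      0ℤ                        ∎

  var-injective : ∀ {i j} → var i ≈ var j → i ≡ j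
  var-injective {i} {j} vars with unit j ≟ unit i
  ... | yes eq = sym (unit-injective eq)
  ... | no neq with () ← begin
      1ℤ                     ≡⟨ δ-≡ {unit i} refl ⟨
      δ (unit i) (unit i)    ≡⟨ coeff-var i (unit i) ⟨
      coeff (var i) (unit i) ≡⟨ vars (unit i) ⟩
      coeff (var j) (unit i) ≡⟨ coeff-var j (unit i) ⟩
      δ (unit i) (unit j)    ≡⟨ δ-≢ neq ⟩
      0ℤ                     ∎

open import Data.Integer using (_+_; _-_; _≤_)

-- Distinct variables are distinct elements and the embedding into the last positions is injective,
-- so a decoration determines the residue of its index.
y-injective : ∀ m {i j} → RawRing._≈_ (𝓡 m) (y m i) (y m j) →
  (i - 1ℤ) %ℕ order m ≡ (j - 1ℤ) %ℕ order m
y-injective m {i} {j} yᵢ≈yⱼ = begin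
  (i - 1ℤ) %ℕ order m                           ≡⟨ Finₚ.toℕ-fromℕ< (n%ℕd<d (i - 1ℤ) (order m)) ⟨
  toℕ (fromℕ< (n%ℕd<d (i - 1ℤ) (order m))) ≡⟨ cong toℕ (Finₚ.↑ʳ-injective m _ _ (var-injective yᵢ≈yⱼ)) ⟩
  toℕ (fromℕ< (n%ℕd<d (j - 1ℤ) (order m))) ≡⟨ Finₚ.toℕ-fromℕ< (n%ℕd<d (j - 1ℤ) (order m)) ⟩
  (j - 1ℤ) %ℕ order m                           ∎
  where open ≡-Reasoning

-- Closed decorated friezes: period and minimality.

module _ {m : ℕ} {W : Family m} (frieze : IsClosedDecoratedFrieze m W) where
  open IsClosedDecoratedFrieze frieze hiding (n)
  open LaurentRing (m ℕ.+ order m)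
  open RawRing (𝓡 m) using (_≈_; 0#) renaming (_*_ to _·_; _+_ to _∔_; -_ to ∸_)

  private
    module R = CommutativeRing commutativeRing
    module G = ThreeTermRelations.Glide commutativeRing *-cancelˡ-nonZero (_+ 1ℤ)
  open G using (_⊕_; next-⊕)

  ⊕≡+ : ∀ i k → i ⊕ k ≡ i + + k
  ⊕≡+ i zero    = sym (ℤₚ.+-identityʳ i)
  ⊕≡+ i (suc k) = trans (⊕≡+ (i + 1ℤ) k) (ℤₚ.+-assoc i 1ℤ (+ k))

  ⊕-difference : ∀ i k → i ⊕ k - i ≡ + k
  ⊕-difference i k = trans (cong (_- i) (⊕≡+ i k)) (cancel i (+ k))
    where
    cancel : ∀ i x → i + x - i ≡ x
    cancel = solve-∀

  -- Row and distance from the diagonal, the coordinates of the abstract argument. Its order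
  -- `2 ℕ.+ n` is `order m` for `n = suc m`.
  entry : ℤ → ℕ → Laurent (m ℕ.+ order m)
  entry i k = W i (i ⊕ k)

  entry-zeroʳ : ∀ i → entry i (order m) ≋ 0#
  entry-zeroʳ i rewrite ⊕≡+ i (order m) = ≈⇒≋ (zeroʳ i)

  entry-boundaryʳ : ∀ i → entry (i + 1ℤ) (2 ℕ.+ m) ≋ y m i
  entry-boundaryʳ i = ≈⇒≋ (subst₂ (λ j l → W (i + 1ℤ) j ≈ y m l) column row (boundaryʳ (i + 1ℤ)))
    where
    cancel : ∀ i → i + 1ℤ - 1ℤ ≡ i
    cancel = solve-∀
    row = cancel i
    column : i + 1ℤ + + order m - 1ℤ ≡ (i + 1ℤ) ⊕ (2 ℕ.+ m)
    -- After reassociation, `+ order m + ℤ.- 1ℤ` evaluates to `+ (2 ℕ.+ m)`.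
    column = trans (ℤₚ.+-assoc (i + 1ℤ) (+ order m) (ℤ.- 1ℤ)) (sym (⊕≡+ (i + 1ℤ) (2 ℕ.+ m)))

  entry-nonzero : ∀ i k → k ℕ.< suc m → ¬ entry i (suc k) ≋ 0#
  -- Distance 1 is on the boundary and outside the range of `nonzero`; there the entry is a
  -- variable.
  entry-nonzero i zero    _   e≋0 = var≉0 _ (λ e → trans (sym (boundaryˡ i e)) (≋⇒≈ e≋0 e))
  entry-nonzero i (suc k) k<m e≋0 = nonzero i (i ⊕ (2 ℕ.+ k))
    (subst (+ 2 ≤_) (sym difference) (+≤+ (s≤s (s≤s z≤n))))
    (subst (_≤ + suc m) (sym difference) (+≤+ k<m))
    (≋⇒≈ e≋0)
    where difference = ⊕-difference i (2 ℕ.+ k)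

  -- The subtracted product is moved across, which gives the subtraction-free form that the semiring
  -- computations of the abstract argument use.
  entry-diamond : ∀ i k → k ℕ.≤ suc m →
    entry i (suc k) · entry (i + 1ℤ) (suc k)
      ≋ y m i · y m (i ⊕ suc k) ∔ entry (i + 1ℤ) k · entry i (2 ℕ.+ k)
  entry-diamond i k k≤1+m = R.trans (R.sym (//-rightDividesˡ _ _)) (R.+-congʳ (≈⇒≋
    (subst (λ l → W i j · W (i + 1ℤ) l ∔ ∸ (W (i + 1ℤ) j · W i l) ≈ y m i · y m j)
      (next-⊕ i (suc k))
      (diamond i j
        (subst (1ℤ ≤_) (sym difference) (+≤+ (s≤s z≤n)))
        (subst (_≤ + (2 ℕ.+ m)) (sym difference) (+≤+ (s≤s k≤1+m)))))))
    where
    open Algebra.Properties.Group R.+-group using (//-rightDividesˡ)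
    j = i ⊕ suc k
    difference = ⊕-difference i (suc k)

  entry-periodic : ∀ i k → k ℕ.≤ order m → entry (i ⊕ order m) k ≋ entry i k
  entry-periodic = G.periodic (y m) entry (λ i e≋0 → var≉0 _ (≋⇒≈ e≋0))
    (λ i → ≈⇒≋ (zeroˡ i)) entry-zeroʳ (λ i → ≈⇒≋ (boundaryˡ i)) entry-boundaryʳ
    entry-nonzero entry-diamond

  order-isPeriod : IsPeriod m W (+ order m)
  order-isPeriod i j 0≤j-i j-i≤n =
    subst₂ _≈_ (cong₂ W (⊕≡+ i (order m)) shifted) (cong (W i) column)
      (≋⇒≈ (entry-periodic i k k≤n))
    where
    k = ℤ.∣ j - i ∣

    +k≡j-i : + k ≡ j - i
    +k≡j-i = ℤₚ.0≤i⇒+∣i∣≡i 0≤j-i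

    k≤n : k ℕ.≤ order m
    k≤n = ℤₚ.drop‿+≤+ (subst (_≤ + order m) (sym +k≡j-i) j-i≤n)

    column : i ⊕ k ≡ j
    column = trans (⊕≡+ i k) (trans (cong (_+_ i) +k≡j-i) (i+[j-i]≡j i j))
      where
      i+[j-i]≡j : ∀ i j → i + (j - i) ≡ j
      i+[j-i]≡j = solve-∀

    shifted : i ⊕ order m ⊕ k ≡ j + + order m
    shifted = trans (⊕≡+ (i ⊕ order m) k) (trans (cong₂ _+_ (⊕≡+ i (order m)) +k≡j-i)
      (i+n+[j-i]≡j+n i j (+ order m)))
      where
      i+n+[j-i]≡j+n : ∀ i j n → i + n + (j - i) ≡ j + n
      i+n+[j-i]≡j+n = solve-∀

  -- The decorations are the entries with `j = i + 1`, so a period of the frieze is one of them too.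
  y-period : ∀ {p} → IsPeriod m W p → ∀ i → y m (i + p) ≈ y m i
  y-period {p} period i e = begin
    coeff (y m (i + p)) e              ≡⟨ boundaryˡ (i + p) e ⟨
    coeff (W (i + p) (i + p + 1ℤ)) e   ≡⟨ cong (λ j → coeff (W (i + p) j) e) (exchange i p 1ℤ) ⟩
    coeff (W (i + p) (i + 1ℤ + p)) e   ≡⟨ period i (i + 1ℤ)
                                            (subst (0ℤ ≤_) (sym difference) (+≤+ z≤n))
                                            (subst (_≤ + order m) (sym difference) (+≤+ (s≤s z≤n))) e ⟩
    coeff (W i (i + 1ℤ)) e             ≡⟨ boundaryˡ i e ⟩
    coeff (y m i) e                    ∎
    where
    open ≡-Reasoning
    difference = ⊕-difference i 1
    exchange : ∀ i p x → i + p + x ≡ i + x + p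
    exchange = solve-∀

  order-least : ∀ q → 0ℤ ℤ.< q → IsPeriod m W q → + order m ≤ q
  -- At `i = 1` the shift of indices by one makes the compared residues those of `q` and `0`. If `q`
  -- were less than the order, its residue would be `suc a`, which is not zero.
  order-least (+ suc a) _ period = +≤+ (ℕₚ.≮⇒≥ λ q<n →
    contradiction (trans (sym (m<n⇒m%n≡m q<n)) (y-injective m {+ suc (suc a)} {1ℤ} (y-period period 1ℤ))) λ ())
  order-least (+ zero) (+<+ ()) _

theorem1p1 : (m : ℕ) (W : Family m) → IsClosedDecoratedFrieze m W →
    ((i j : ℤ) → 0ℤ ≤ j - i → j - i ≤ + order m →
    RawRing._≈_ (𝓡 m) (W (i + + order m) (j + + order m)) (W i j))
    × IsLeastPositivePeriod m W (+ order m)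
theorem1p1 m W frieze = order-isPeriod frieze , record
  { positive = +<+ (s≤s z≤n)
  ; isPeriod = order-isPeriod frieze
  ; least    = order-least frieze
  }
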